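{- Let $G$ be a connected input graph with $n$ vertices, and let $\mathcal{O}^*(f(k))$ be the running time of an algorithm enumerating all vertex covers of size at most $k$ of $G$. Then there is an algorithm that correctly decides in $\mathcal{O}^*(f(k))$ time whether $G$ has an independent cutset of size at least $n-k$.
   Context: All graphs are finite, simple, loopless and undirected. A set $S$ of vertices of a graph $G$ is a cutset of $G$ if $G-S$ is disconnected; it is an independent set if its vertices are pairwise nonadjacent. An independent cutset of $G$ is a set of vertices that is both a cutset and an independent set of $G$. A vertex cover of $G$ is a set of vertices $X$ such that for every edge $uv\in E(G)$ we have $u\in X$ or $v\in X$. The notation $\mathcal{O}^*$ is the $\mathcal{O}$-notation with factors polynomial in the input size suppressed. -}

module Defs where

open import Data.Bool using (Bool; true; false)
open import Data.Fin using (Fin; zero)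
open import Data.Fin.Subset using (Subset; _∈_; _∉_; ∣_∣)
open import Data.List using (List; []; _∷_; tabulate)
import Data.List.Membership.Propositional as List
open import Data.Nat using (ℕ; zero; suc; _+_; _*_; _∸_; _^_; _≤_)
open import Data.Nat.Binary using (ℕᵇ; zero; 2[1+_]; 1+[2_]; fromℕ)
open import Data.Product using (Σ; ∃; ∃₂; _×_; proj₁)
open import Data.Sum using (_⊎_)
open import Data.Vec as Vec using (Vec; _∷_; lookup; replicate; toList; _[_]≔_)
open import Function using (_⇔_; _on_)
open import Level using (0ℓ)
open import Relation.Binary using (Rel)
open import Relation.Binary.Construct.Closure.ReflexiveTransitive using (Star)
open import Relation.Binary.PropositionalEquality using (_≡_)
open import Relation.Nullary using (¬_; Dec; does)

------------------------------------------------------------------------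
-- Graphs

record Graph (n : ℕ) : Set where
  field
    adj      : Fin n → Fin n → Bool
    adj-sym  : ∀ u v → adj u v ≡ adj v u
    loopless : ∀ v → adj v v ≡ false

  Adj : Rel (Fin n) 0ℓ
  Adj u v = adj u v ≡ true

open Graph public

-- Connectedness of the graph with vertex type V and edge relation E.
-- The graph without vertices counts as connected.
Connected : {V : Set} → Rel V 0ℓ → Set
Connected E = ∀ u v → Star E u v

module _ {n : ℕ} (G : Graph n) where

  -- The edge relation of G − S, the subgraph induced on the complement of
  -- S.  (Proofs of v ∉ S are definitionally equal, so no vertex is
  -- duplicated.)
  _∖_ : (S : Subset n) → Rel (∃ (_∉ S)) 0ℓ
  _∖_ S = Adj G on proj₁

  Cutset : Subset n → Set
  Cutset S = ¬ Connected (_∖_ S)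

  Independent : Subset n → Set
  Independent S = ∀ u v → u ∈ S → v ∈ S → ¬ Adj G u v

  VertexCover : Subset n → Set
  VertexCover X = ∀ u v → Adj G u v → u ∈ X ⊎ v ∈ X

  -- For k > n truncated subtraction imposes no bound, as n − k ≤ 0 does.
  HasIndependentCutset≥n- : ℕ → Set
  HasIndependentCutset≥n- k =
    ∃ λ (S : Subset n) → Cutset S × Independent S × n ∸ k ≤ ∣ S ∣

------------------------------------------------------------------------
-- The machine model: Jones's WHILE language over binary trees, with unit
-- cost per elementary operation (assignment copies a pointer, so `cons',
-- `hd' and `tl' are constant-time).  It is polynomially equivalent to
-- Turing machines.

data Tree : Set where
  nil  : Tree
  cons : Tree → Tree → Tree

size : Tree → ℕ
size nil        = 1
size (cons l r) = suc (size l + size r)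

head tail : Tree → Tree
head nil        = nil
head (cons l _) = l
tail nil        = nil
tail (cons _ r) = r

data Expr (m : ℕ) : Set where
  var  : Fin m → Expr m
  nil  : Expr m
  cons : Expr m → Expr m → Expr m
  hd   : Expr m → Expr m
  tl   : Expr m → Expr m

infix  6 _:=_
infixr 5 _⨾_

data Cmd (m : ℕ) : Set where
  _:=_          : Fin m → Expr m → Cmd m
  _⨾_           : Cmd m → Cmd m → Cmd m
  if_then_else_ : Expr m → Cmd m → Cmd m → Cmd m
  while_loop_     : Expr m → Cmd m → Cmd m

Store : ℕ → Set
Store = Vec Tree

eval : ∀ {m} → Expr m → Store m → Tree
eval (var x)    σ = lookup σ x
eval nil        σ = nil
eval (cons a b) σ = cons (eval a σ) (eval b σ)
eval (hd a)     σ = head (eval a σ)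
eval (tl a)     σ = tail (eval a σ)

cost : ∀ {m} → Expr m → ℕ
cost (var _)    = 1
cost nil        = 1
cost (cons a b) = suc (cost a + cost b)
cost (hd a)     = suc (cost a)
cost (tl a)     = suc (cost a)

-- In tests, nil is false and every other tree is true.
data Truthy : Tree → Set where
  truthy : ∀ {l r} → Truthy (cons l r)

infix 4 ⟨_,_⟩⇓[_]_

-- ⟨ c , σ ⟩⇓[ t ] τ : started in store σ, the command c terminates in
-- store τ after t steps.
data ⟨_,_⟩⇓[_]_ {m : ℕ} : Cmd m → Store m → ℕ → Store m → Set where
  assign : ∀ {x e σ} →
    ⟨ x := e , σ ⟩⇓[ suc (cost e) ] (σ [ x ]≔ eval e σ)
  seq : ∀ {a b σ τ υ s t} →
    ⟨ a , σ ⟩⇓[ s ] τ → ⟨ b , τ ⟩⇓[ t ] υ →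
    ⟨ a ⨾ b , σ ⟩⇓[ s + t ] υ
  if-true : ∀ {e a b σ τ t} → Truthy (eval e σ) →
    ⟨ a , σ ⟩⇓[ t ] τ →
    ⟨ if e then a else b , σ ⟩⇓[ suc (cost e + t) ] τ
  if-false : ∀ {e a b σ τ t} → eval e σ ≡ nil →
    ⟨ b , σ ⟩⇓[ t ] τ →
    ⟨ if e then a else b , σ ⟩⇓[ suc (cost e + t) ] τ
  while-true : ∀ {e a σ τ υ s t} → Truthy (eval e σ) →
    ⟨ a , σ ⟩⇓[ s ] τ → ⟨ while e loop a , τ ⟩⇓[ t ] υ →
    ⟨ while e loop a , σ ⟩⇓[ suc (cost e + (s + t)) ] υ
  while-false : ∀ {e a σ} → eval e σ ≡ nil →
    ⟨ while e loop a , σ ⟩⇓[ suc (cost e) ] σ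

-- Variable zero holds the input at the start and the output at the end;
-- all other variables are initially nil.
record Program : Set where
  field
    locals : ℕ
    body   : Cmd (suc locals)

open Program public

Runs : Program → (input output : Tree) (time : ℕ) → Set
Runs p i o t = ∃ λ τ →
  ⟨ body p , i ∷ replicate (locals p) nil ⟩⇓[ t ] τ × lookup τ zero ≡ o

------------------------------------------------------------------------
-- Encodings

encBool : Bool → Tree
encBool false = nil
encBool true  = cons nil nil

encList : {A : Set} → (A → Tree) → List A → Tree
encList enc []       = nil
encList enc (x ∷ xs) = cons (enc x) (encList enc xs)

encℕᵇ : ℕᵇ → Tree
encℕᵇ zero     = nil
encℕᵇ 2[1+ b ] = cons (encBool false) (encℕᵇ b)
encℕᵇ 1+[2 b ] = cons (encBool true) (encℕᵇ b)

-- A vertex set is its characteristic bit list.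
encSubset : ∀ {n} → Subset n → Tree
encSubset S = encList encBool (toList S)

-- A graph is the list of rows of its adjacency matrix.
encGraph : ∀ {n} → Graph n → Tree
encGraph G = encList encSubset (tabulate λ u → Vec.tabulate (adj G u))

encInput : ∀ {n} → Graph n → ℕ → Tree
encInput G k = cons (encGraph G) (encℕᵇ (fromℕ k))

------------------------------------------------------------------------
-- Algorithmic problems on instances (G , k)

-- The input graphs of an algorithm.  On all connected graphs no bound in k
-- alone is possible for enumerating vertex covers of size at most k (a star
-- on n vertices has about n ^ (k − 1) of them), on restricted classes it is.
GraphClass : Set₁
GraphClass = ∀ {n} → Graph n → Set

-- The acceptable outputs on each instance.
Problem : Set₁
Problem = ∀ {n} → Graph n → ℕ → Tree → Set

-- p is correct on all inputs (G , k) with G in 𝒢, and runs on them in time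
-- 𝒪*(f(k)), that is, f(k) times a polynomial in the input size.  (As sizes
-- are positive, every polynomial is bounded by some c * size ^ d.)
_solves_on_in𝒪*_ : Program → Problem → GraphClass → (ℕ → ℕ) → Set
p solves P on 𝒢 in𝒪* f =
  ∃₂ λ c d → ∀ {n} (G : Graph n) → 𝒢 G → ∀ k →
  ∃₂ λ out t →
    Runs p (encInput G k) out t ×
    P G k out ×
    t ≤ c * size (encInput G k) ^ d * f k

-- The output lists exactly the vertex covers of size at most k, in any
-- order and possibly with repetitions.
VertexCoverEnumeration : Problem
VertexCoverEnumeration {n} G k out = ∃ λ (L : List (Subset n)) →
  out ≡ encList encSubset L ×
  (∀ X → X List.∈ L ⇔ (VertexCover G X × ∣ X ∣ ≤ k))

IndependentCutsetDecision : Problem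
IndependentCutsetDecision G k out =
  Σ (Dec (HasIndependentCutset≥n- G k)) λ d → out ≡ encBool (does d)

{-# OPTIONS --safe #-}

-- An independent set S is the complement of a vertex cover X, and G − S is
-- then G[X].  So one lists the covers of size at most k and tests each G[X]
-- for connectedness: starting from U = X, repeatedly drop from U the first
-- vertex of X and all vertices with a neighbour in X \ U.  After n rounds U
-- is stable, and G[X] is connected iff U is empty.  The number of covers to
-- test is polynomially bounded in the running time of the enumeration, since
-- that running time bounds the growth of the height of all trees in the store.
module Submission where

open import Defs
open import Data.Bool using (Bool; true; false; _∧_; _∨_; not)
open import Data.Bool.ListAction using (any)
open import Data.Bool.Properties using (∨-assoc; ¬-not)
open import Data.Empty using (⊥)
open import Data.Fin using (Fin; zero; suc; #_; _↑ˡ_; _↑ʳ_)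
open import Data.Fin.Properties using (_≟_)
open import Data.Fin.Subset using (Subset; _∉_; _⊆_; ∣_∣; ∁)
open import Data.Fin.Subset.Properties
  using (_⊂?_; _∈?_; ⊆-antisym; p⊂q⇒∣p∣<∣q∣; ∣p∣≤n; ∣∁p∣≡n∸∣p∣;
         x∉∁p⇒x∈p; x∈p⇒x∉∁p; x∈∁p⇒x∉p; x∉p⇒x∈∁p)
open import Data.List as List using (List; []; _∷_; _ʳ++_; tabulate)
import Data.List.Membership.Propositional as List
open import Data.List.Properties using (reverse-involutive; length-reverse; length-tabulate)
open import Data.List.Relation.Unary.Any using (here; there)
open import Data.Nat
  using (ℕ; zero; suc; _+_; _*_; _∸_; _^_; _⊔_; _≤_; _<_; s≤s; z≤n; NonZero; >-nonZero)
open import Data.Nat.Properties hiding (_≟_)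
open import Data.Nat.Tactic.RingSolver using (solve-∀)
open import Data.Product using (∃; ∃₂; _×_; _,_; proj₁)
open import Data.Sum using (_⊎_; inj₁; inj₂; [_,_]′)
open import Data.Unit using (⊤)
open import Data.Vec as Vec using (Vec; []; _∷_; _++_; lookup; replicate; toList; foldl′; _[_]≔_)
open import Data.Vec.Properties
  using (lookup-++ʳ; []≔-++-↑ʳ; length-toList; lookup∘tabulate; lookup∘update; lookup∘update′;
         lookup-replicate; []=⇒lookup; lookup⇒[]=)
open import Function using (_∘_; _⇔_; Equivalence)
open import Relation.Binary.Construct.Closure.ReflexiveTransitive
  using (Star; ε; _◅_; _◅◅_; reverse)
open import Relation.Binary.PropositionalEquality
  using (_≡_; refl; sym; trans; cong; cong₂; subst; subst₂; module ≡-Reasoning)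
open import Relation.Nullary using (¬_; yes; no; contradiction)

private variable
  m n l s t : ℕ

-- Running commands within a time bound

infix 4 ⟨_,_⟩⇓≤[_]_
infixr 5 _⨟_

-- Exact step counts depend on the branches taken; upper bounds can be given in terms of list
-- lengths alone.
⟨_,_⟩⇓≤[_]_ : Cmd m → Store m → ℕ → Store m → Set
⟨ c , σ ⟩⇓≤[ b ] τ = ∃ λ t → ⟨ c , σ ⟩⇓[ t ] τ × t ≤ b

_⨟_ : ∀ {a b : Cmd m} {σ τ υ} →
  ⟨ a , σ ⟩⇓≤[ s ] τ → ⟨ b , τ ⟩⇓≤[ t ] υ → ⟨ a ⨾ b , σ ⟩⇓≤[ s + t ] υ
(_ , a⇓ , ≤s) ⨟ (_ , b⇓ , ≤t) = _ , seq a⇓ b⇓ , +-mono-≤ ≤s ≤t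

-- Opaque, as otherwise the unifier unfolds the products of the nested loops.
opaque
  loopTime : (rounds step : ℕ) → ℕ
  loopTime k t = k * (2 + t)

opaque
  unfolding loopTime

  -- The failing last test counts as a round of its own, so a loop over a list of length `n` takes
  -- `loopTime (suc n)`. The `2` in `loopTime` pays for one test of a variable.
  while-done : ∀ {x} {c : Cmd m} {σ} → lookup σ x ≡ nil →
    ⟨ while var x loop c , σ ⟩⇓≤[ loopTime 1 t ] σ
  while-done x≡nil = _ , while-false x≡nil , s≤s (s≤s z≤n)

  while-step : ∀ {x} {c : Cmd m} {σ τ υ k} → Truthy (lookup σ x) →
    ⟨ c , σ ⟩⇓≤[ t ] τ → ⟨ while var x loop c , τ ⟩⇓≤[ loopTime k t ] υ →
    ⟨ while var x loop c , σ ⟩⇓≤[ loopTime (suc k) t ] υ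
  while-step x≢nil (_ , c⇓ , ≤t) (_ , w⇓ , ≤kt) =
    _ , while-true x≢nil c⇓ w⇓ , s≤s (s≤s (+-mono-≤ ≤t ≤kt))

-- Evaluation of loop-free commands

LoopFree : Cmd m → Set
LoopFree (_ := _)              = ⊤
LoopFree (a ⨾ b)               = LoopFree a × LoopFree b
LoopFree (if _ then a else b)  = LoopFree a × LoopFree b
LoopFree (while _ loop _)      = ⊥

branch : {A : Set} → Tree → A → A → A
branch nil        _ b = b
branch (cons _ _) a _ = a

-- As a function on stores, the effect of straight-line code is found by normalisation. The value on
-- loops is a dummy, excluded by `LoopFree` in `run⇓`.
run : Cmd m → Store m → Store m
run (x := e)              σ = σ [ x ]≔ eval e σ
run (a ⨾ b)               σ = run b (run a σ)
run (if e then a else b)  σ = branch (eval e σ) (run a σ) (run b σ)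
run (while _ loop _)      σ = σ

bound : Cmd m → ℕ
bound (_ := e)             = suc (cost e)
bound (a ⨾ b)              = bound a + bound b
bound (if e then a else b) = suc (cost e + (bound a + bound b))
bound (while _ loop _)     = 0

-- For a concrete command, `LoopFree c` reduces to a product of unit types, so eta fills in the
-- implicit argument.
run⇓ : (c : Cmd m) {_ : LoopFree c} (σ : Store m) → ⟨ c , σ ⟩⇓≤[ bound c ] run c σ
run⇓ (x := e) σ = _ , assign , ≤-refl
run⇓ (a ⨾ b) {fa , fb} σ = run⇓ a {fa} σ ⨟ run⇓ b {fb} _
run⇓ (if e then a else b) {fa , fb} σ with eval e σ in eq
... | nil with _ , b⇓ , ≤b ← run⇓ b {fb} σ =
  _ , if-false eq b⇓ , s≤s (+-monoʳ-≤ (cost e) (≤-trans ≤b (m≤n+m _ _)))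
... | cons _ _ with _ , a⇓ , ≤a ← run⇓ a {fa} σ =
  _ , if-true (subst Truthy (sym eq) truthy) a⇓ , s≤s (+-monoʳ-≤ (cost e) (≤-trans ≤a (m≤m+n _ _)))

-- Shifting the variables of a command

module _ (m : ℕ) where

  shiftᵉ : Expr n → Expr (m + n)
  shiftᵉ (var x)    = var (m ↑ʳ x)
  shiftᵉ nil        = nil
  shiftᵉ (cons a b) = cons (shiftᵉ a) (shiftᵉ b)
  shiftᵉ (hd a)     = hd (shiftᵉ a)
  shiftᵉ (tl a)     = tl (shiftᵉ a)

  shift : Cmd n → Cmd (m + n)
  shift (x := e)             = (m ↑ʳ x) := shiftᵉ e
  shift (a ⨾ b)              = shift a ⨾ shift b
  shift (if e then a else b) = if shiftᵉ e then shift a else (shift b)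
  shift (while e loop a)     = while shiftᵉ e loop (shift a)

module _ {m : ℕ} (ρ : Store m) where

  eval-shift : (e : Expr n) (σ : Store n) → eval (shiftᵉ m e) (ρ ++ σ) ≡ eval e σ
  eval-shift (var x)    σ = lookup-++ʳ ρ σ x
  eval-shift nil        σ = refl
  eval-shift (cons a b) σ = cong₂ cons (eval-shift a σ) (eval-shift b σ)
  eval-shift (hd a)     σ = cong head (eval-shift a σ)
  eval-shift (tl a)     σ = cong tail (eval-shift a σ)

  cost-shift : (e : Expr n) → cost (shiftᵉ m e) ≡ cost e
  cost-shift (var x)    = refl
  cost-shift nil        = refl
  cost-shift (cons a b) = cong suc (cong₂ _+_ (cost-shift a) (cost-shift b))
  cost-shift (hd a)     = cong suc (cost-shift a)
  cost-shift (tl a)     = cong suc (cost-shift a)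

  -- A shifted command neither reads nor writes the first `m` variables. Thus the enumeration can
  -- run, equally fast, beside the registers of the decision program.
  shift⇓ : ∀ {c : Cmd n} {σ τ t} → ⟨ c , σ ⟩⇓[ t ] τ → ⟨ shift m c , ρ ++ σ ⟩⇓[ t ] (ρ ++ τ)
  shift⇓ (assign {x} {e} {σ}) =
    subst₂ (⟨ shift m (x := e) , ρ ++ σ ⟩⇓[_]_) (cong suc (cost-shift e))
      (trans (cong ((ρ ++ σ) [ m ↑ʳ x ]≔_) (eval-shift e σ)) ([]≔-++-↑ʳ ρ σ x)) assign
  shift⇓ (seq a⇓ b⇓) = seq (shift⇓ a⇓) (shift⇓ b⇓)
  shift⇓ (if-true {e} {σ = σ} e≢nil a⇓) rewrite sym (cost-shift e) =
    if-true (subst Truthy (sym (eval-shift e σ)) e≢nil) (shift⇓ a⇓)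
  shift⇓ (if-false {e} {σ = σ} e≡nil b⇓) rewrite sym (cost-shift e) =
    if-false (trans (eval-shift e σ) e≡nil) (shift⇓ b⇓)
  shift⇓ (while-true {e} {σ = σ} e≢nil a⇓ w⇓) rewrite sym (cost-shift e) =
    while-true (subst Truthy (sym (eval-shift e σ)) e≢nil) (shift⇓ a⇓) (shift⇓ w⇓)
  shift⇓ (while-false {e} {σ = σ} e≡nil) rewrite sym (cost-shift e) =
    while-false (trans (eval-shift e σ) e≡nil)

-- Although trees share subtrees, so that their size may grow exponentially
-- with the running time, their height grows at most linearly.

height : Tree → ℕ
height nil        = 0
height (cons l r) = suc (height l ⊔ height r)

height-head : ∀ t → height (head t) ≤ height t
height-head nil        = z≤n
height-head (cons l r) = m≤n⇒m≤1+n (m≤m⊔n _ _)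

height-tail : ∀ t → height (tail t) ≤ height t
height-tail nil        = z≤n
height-tail (cons l r) = m≤n⇒m≤1+n (m≤n⊔m _ _)

height≤size : ∀ t → height t ≤ size t
height≤size nil        = z≤n
height≤size (cons l r) = s≤s (≤-trans (⊔-mono-≤ (height≤size l) (height≤size r)) (m⊔n≤m+n (size l) (size r)))

length≤height : ∀ {A : Set} (enc : A → Tree) xs → List.length xs ≤ height (encList enc xs)
length≤height enc []       = z≤n
length≤height enc (x ∷ xs) = s≤s (≤-trans (length≤height enc xs) (m≤n⊔m _ _))

length<size : ∀ {A : Set} (enc : A → Tree) xs → List.length xs < size (encList enc xs)
length<size enc []       = s≤s z≤n
length<size enc (x ∷ xs) = s≤s (≤-trans (length<size enc xs) (m≤n+m _ _))

Low : ℕ → Store m → Set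
Low h σ = ∀ x → height (lookup σ x) ≤ h

-- Only `cons` adds height, one level for one unit of cost.
eval-height : ∀ (e : Expr m) {σ h} → Low h σ → height (eval e σ) ≤ cost e + h
eval-height (var x) low = m≤n⇒m≤1+n (low x)
eval-height nil     low = z≤n
eval-height (cons a b) {h = h} low = s≤s (⊔-lub
  (≤-trans (eval-height a low) (+-monoˡ-≤ h (m≤m+n (cost a) (cost b))))
  (≤-trans (eval-height b low) (+-monoˡ-≤ h (m≤n+m (cost b) (cost a)))))
eval-height (hd e) low = m≤n⇒m≤1+n (≤-trans (height-head _) (eval-height e low))
eval-height (tl e) low = m≤n⇒m≤1+n (≤-trans (height-tail _) (eval-height e low))

low-mono : ∀ (σ : Store m) {g h} → g ≤ h → Low g σ → Low h σ
low-mono σ g≤h low x = ≤-trans (low x) g≤h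

-- Assignments raise the height by at most their cost and tests leave the store alone, so the
-- increments add up along the run.
⇓-low : ∀ {c : Cmd m} {σ τ t h} → ⟨ c , σ ⟩⇓[ t ] τ → Low h σ → Low (t + h) τ
⇓-low {h = h} (assign {x} {e} {σ}) low y with y ≟ x
... | yes refl = subst (_≤ suc (cost e) + h) (cong height (sym (lookup∘update x σ (eval e σ))))
  (m≤n⇒m≤1+n (eval-height e low))
... | no  y≢x  = subst (_≤ suc (cost e) + h) (cong height (sym (lookup∘update′ y≢x σ (eval e σ))))
  (m≤n⇒m≤o+n (suc (cost e)) (low y))
⇓-low {τ = τ} {h = h} (seq {s = s} {t} a⇓ b⇓) low =
  low-mono τ (≤-reflexive (trans (sym (+-assoc t s h)) (cong (_+ h) (+-comm t s)))) (⇓-low b⇓ (⇓-low a⇓ low))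
⇓-low {τ = τ} {h = h} (if-true {e} {t = t} _ a⇓) low =
  low-mono τ (+-monoˡ-≤ h (m≤n⇒m≤o+n (suc (cost e)) ≤-refl)) (⇓-low a⇓ low)
⇓-low {τ = τ} {h = h} (if-false {e} {t = t} _ b⇓) low =
  low-mono τ (+-monoˡ-≤ h (m≤n⇒m≤o+n (suc (cost e)) ≤-refl)) (⇓-low b⇓ low)
⇓-low {τ = τ} {h = h} (while-true {e} {s = s} {t} _ a⇓ w⇓) low =
  low-mono τ (≤-trans (≤-reflexive (trans (sym (+-assoc t s h)) (cong (_+ h) (+-comm t s))))
      (+-monoˡ-≤ h (m≤n⇒m≤o+n (suc (cost e)) ≤-refl)))
    (⇓-low w⇓ (⇓-low a⇓ low))
⇓-low (while-false {e} {σ = σ} _) low = low-mono σ (m≤n+m _ (suc (cost e))) low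

⇓-pos : ∀ {c : Cmd m} {σ τ t} → ⟨ c , σ ⟩⇓[ t ] τ → 1 ≤ t
⇓-pos assign            = s≤s z≤n
⇓-pos (seq a⇓ _)        = ≤-trans (⇓-pos a⇓) (m≤m+n _ _)
⇓-pos (if-true _ _)     = s≤s z≤n
⇓-pos (if-false _ _)    = s≤s z≤n
⇓-pos (while-true _ _ _) = s≤s z≤n
⇓-pos (while-false _)   = s≤s z≤n

initial-low : ∀ i l → Low (height i) (i ∷ replicate l nil)
initial-low i l zero    = ≤-refl
initial-low i l (suc x) = subst (λ t → height t ≤ height i) (sym (lookup-replicate x nil)) z≤n

-- An encoded list is at least as high as it is long. This bounds the number of covers, hence of
-- rounds of `coverLoop`.
length-output : ∀ {A : Set} (enc : A → Tree) (p : Program) {i t} xs → Runs p i (encList enc xs) t →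
  List.length xs ≤ t + size i
length-output enc p {i} {t} xs (τ , p⇓ , τ₀≡) = begin
  List.length xs            ≤⟨ length≤height enc xs ⟩
  height (encList enc xs)   ≡⟨ cong height τ₀≡ ⟨
  height (lookup τ zero)    ≤⟨ ⇓-low p⇓ (initial-low i (locals p)) zero ⟩
  t + height i              ≤⟨ +-monoʳ-≤ t (height≤size i) ⟩
  t + size i                ∎
  where open ≤-Reasoning

-- The connectedness test

touches : Vec Bool n → Subset n → Subset n → Bool
touches []       []       []       = false
touches (a ∷ as) (x ∷ xs) (u ∷ us) = (a ∧ (x ∧ not u)) ∨ touches as xs us

-- The new membership bit of a vertex in `U`, the set not yet reached. As `seen` records an earlier
-- vertex of `X`, the case `false true` is the first vertex of `X`, where the search starts.
survives : (seen x touched u : Bool) → Bool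
survives _     false _     u = u
survives false true  _     _ = false
survives true  true  true  _ = false
survives true  true  false u = u

or : Vec Bool n → Bool
or []       = false
or (x ∷ xs) = x ∨ or xs

module _ (X U : Subset n) where

  -- Neighbourhoods shrink along with the two scanned vectors, but `X` and `U` stay whole, so that
  -- every vertex is judged by the old `U`.
  sweep : Bool → (Fin m → Subset n) → Vec Bool m → Vec Bool m → Vec Bool m
  sweep seen N []       []       = []
  sweep seen N (x ∷ xs) (u ∷ us) =
    survives seen x (touches (N zero) X U) u ∷ sweep (seen ∨ x) (N ∘ suc) xs us

iter : {A : Set} → ℕ → (A → A) → A → A
iter zero    f a = a
iter (suc k) f a = iter k f (f a)

prune : (Fin n → Subset n) → Subset n → Subset n → Subset n
prune N X U = sweep X U false N X U

residue : (Fin n → Subset n) → Subset n → Subset n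
residue {n} N X = iter n (prune N X) X

-- Stabilisation of shrinking iterations

iter-⊆ : ∀ {f : Subset n → Subset n} → (∀ U → f U ⊆ U) → ∀ k U → iter k f U ⊆ U
iter-⊆ f⊆ zero    U = λ x∈U → x∈U
iter-⊆ f⊆ (suc k) U = f⊆ U ∘ iter-⊆ f⊆ k _

iter-fixed : ∀ {A : Set} {f : A → A} {a} → f a ≡ a → ∀ k → iter k f a ≡ a
iter-fixed fa≡a zero    = refl
iter-fixed {f = f} fa≡a (suc k) = trans (cong (iter k f) fa≡a) (iter-fixed fa≡a k)

⊆⇒≡⊎∣<∣ : ∀ {p q : Subset n} → p ⊆ q → p ≡ q ⊎ ∣ p ∣ < ∣ q ∣
⊆⇒≡⊎∣<∣ {p = p} {q} p⊆q with p ⊂? q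
... | yes p⊂q = inj₂ (p⊂q⇒∣p∣<∣q∣ p⊂q)
... | no  p⊄q = inj₁ (⊆-antisym p⊆q q⊆p)
  where
  q⊆p : q ⊆ p
  q⊆p {x} x∈q with x ∈? p
  ... | yes x∈p = x∈p
  ... | no  x∉p = contradiction ((λ {y} → p⊆q {y}) , x , x∈q , x∉p) p⊄q

-- A round either changes nothing, and then no later round does, or makes the set smaller, which can
-- happen at most `k` times.
iter-stable : ∀ {f : Subset n → Subset n} → (∀ U → f U ⊆ U) →
  ∀ k U → ∣ U ∣ ≤ k → f (iter k f U) ≡ iter k f U
iter-stable {f = f} f⊆ k U ∣U∣≤k with ⊆⇒≡⊎∣<∣ (f⊆ U)
iter-stable {f = f} f⊆ k U ∣U∣≤k | inj₁ fU≡U =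
  trans (cong f (iter-fixed fU≡U k)) (trans fU≡U (sym (iter-fixed fU≡U k)))
iter-stable f⊆ zero    U ∣U∣≤0 | inj₂ lt = contradiction (≤-trans lt ∣U∣≤0) λ ()
iter-stable {f = f} f⊆ (suc k) U ∣U∣≤k | inj₂ lt =
  iter-stable f⊆ k (f U) (≤-pred (≤-trans lt ∣U∣≤k))

-- Correctness of the connectedness test

touches⁺ : ∀ (as xs us : Vec Bool n) j → lookup as j ≡ true → lookup xs j ≡ true →
  lookup us j ≡ false → touches as xs us ≡ true
touches⁺ (_ ∷ _) (_ ∷ _) (_ ∷ _) zero refl refl refl = refl
touches⁺ (a ∷ as) (x ∷ xs) (u ∷ us) (suc j) aj xj uj with a ∧ (x ∧ not u)
... | true  = refl
... | false = touches⁺ as xs us j aj xj uj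

touches⁻ : ∀ (as xs us : Vec Bool n) → touches as xs us ≡ true →
  ∃ λ j → lookup as j ≡ true × lookup xs j ≡ true × lookup us j ≡ false
touches⁻ [] [] [] ()
touches⁻ (true ∷ as) (true ∷ xs) (false ∷ us) _ = zero , refl , refl , refl
touches⁻ (true ∷ as) (true ∷ xs) (true ∷ us) t with j , h ← touches⁻ as xs us t = suc j , h
touches⁻ (true ∷ as) (false ∷ xs) (_ ∷ us) t with j , h ← touches⁻ as xs us t = suc j , h
touches⁻ (false ∷ as) (_ ∷ xs) (_ ∷ us) t with j , h ← touches⁻ as xs us t = suc j , h

or-true : ∀ (v : Vec Bool n) → or v ≡ true → ∃ λ i → lookup v i ≡ true
or-true (true ∷ v)  _ = zero , refl
or-true (false ∷ v) t with i , vi ← or-true v t = suc i , vi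

or-false : ∀ (v : Vec Bool n) → or v ≡ false → ∀ i → lookup v i ≡ false
or-false (false ∷ v) _ zero    = refl
or-false (false ∷ v) f (suc i) = or-false v f i

-- The value that `seen` has when a sweep started from `false` arrives at position `i`.
marked-before : Vec Bool n → Fin n → Bool
marked-before (_ ∷ _)  zero    = false
marked-before (x ∷ xs) (suc i) = x ∨ marked-before xs i

First : Vec Bool n → Fin n → Set
First xs i = lookup xs i ≡ true × marked-before xs i ≡ false

first : ∀ (xs : Vec Bool n) i → lookup xs i ≡ true → ∃ (First xs)
first (true ∷ xs)  _       _  = zero , refl , refl
first (false ∷ xs) (suc i) xi with j , fj ← first xs i xi = suc j , fj

First-unique : ∀ (xs : Vec Bool n) {i j} → First xs i → First xs j → i ≡ j
First-unique (_ ∷ _)      {zero}  {zero}  _         _         = refl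
First-unique (true ∷ _)   {zero}  {suc _} _         (_ , ())
First-unique (true ∷ _)   {suc _} {_}     (_ , ())  _
First-unique (false ∷ xs) {suc i} {suc j} fi        fj        = cong suc (First-unique xs fi fj)

-- Turns the scan into a condition on each vertex separately. The split on `s` lets the disjunctions
-- compute.
lookup-sweep : ∀ (X U : Subset n) s (N : Fin m → Subset n) xs us i →
  lookup (sweep X U s N xs us) i
    ≡ survives (s ∨ marked-before xs i) (lookup xs i) (touches (N i) X U) (lookup us i)
lookup-sweep X U false N (x ∷ xs) (u ∷ us) zero = refl
lookup-sweep X U true  N (x ∷ xs) (u ∷ us) zero = refl
lookup-sweep X U false N (x ∷ xs) (u ∷ us) (suc i) = lookup-sweep X U x (N ∘ suc) xs us i
lookup-sweep X U true  N (x ∷ xs) (u ∷ us) (suc i) = lookup-sweep X U true (N ∘ suc) xs us i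

survives⇒alive : ∀ s x h u → survives s x h u ≡ true → u ≡ true
survives⇒alive _     false _     u u≡true = u≡true
survives⇒alive true  true  false u u≡true = u≡true

survives⇒untouched : ∀ s h u → survives s true h u ≡ true → h ≡ false
survives⇒untouched true false _ _ = refl

perishes : ∀ s h u → survives s true h u ≡ false → s ≡ false ⊎ h ≡ true ⊎ u ≡ false
perishes false _     _ _ = inj₁ refl
perishes true  true  _ _ = inj₂ (inj₁ refl)
perishes true  false _ u≡false = inj₂ (inj₂ u≡false)

prune-⊆ : ∀ (N : Fin n → Subset n) X U → prune N X U ⊆ U
prune-⊆ N X U {i} i∈ = lookup⇒[]= i U
  (survives⇒alive _ (lookup X i) _ _ (trans (sym (lookup-sweep X U false N X U i)) ([]=⇒lookup i∈)))

module _ (G : Graph n) where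

  nbhd : Fin n → Subset n
  nbhd u = Vec.tabulate (adj G u)

  module _ (X : Subset n) where

    private
      V = ∃ (_∉ ∁ X)
      E = _∖_ G (∁ X)
      f = prune nbhd X

    prune-residue : f (residue nbhd X) ≡ residue nbhd X
    prune-residue = iter-stable (prune-⊆ nbhd X) n X (∣p∣≤n X)

    -- If `j` were still in the residue, its neighbour `i`, in `X` but outside the residue, would
    -- remove it in one more round; but the residue is a fixed point of pruning.
    residue-stable : ∀ {i j} → Adj G i j → lookup X i ≡ true → lookup X j ≡ true →
      lookup (residue nbhd X) i ≡ false → lookup (residue nbhd X) j ≡ false
    residue-stable {i} {j} ij Xi Xj i∉R = ¬-not λ j∈R → contradiction
      (trans (sym (touches⁺ (nbhd j) X R i
          (trans (lookup∘tabulate (adj G j) i) (trans (adj-sym G j i) ij)) Xi i∉R))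
        (survives⇒untouched (marked-before X j) _ _ (begin
          survives (marked-before X j) true (touches (nbhd j) X R) (lookup R j)
            ≡⟨ cong (λ x → survives (marked-before X j) x (touches (nbhd j) X R) (lookup R j)) Xj ⟨
          survives (marked-before X j) (lookup X j) (touches (nbhd j) X R) (lookup R j)
            ≡⟨ lookup-sweep X R false nbhd X R j ⟨
          lookup (f R) j
            ≡⟨ cong (λ U → lookup U j) prune-residue ⟩
          lookup R j
            ≡⟨ j∈R ⟩
          true ∎)))
      λ ()
      where
      open ≡-Reasoning
      R = residue nbhd X

    First∉prune : ∀ {s} → First X s → ∀ U → lookup (f U) s ≡ false
    First∉prune {s} (Xs , none) U = trans (lookup-sweep X U false nbhd X U s)
      (cong₂ (λ b x → survives b x (touches (nbhd s) X U) (lookup U s)) none Xs)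

    inX : (v : V) → lookup X (proj₁ v) ≡ true
    inX (_ , v∉∁X) = []=⇒lookup (x∉∁p⇒x∈p v∉∁X)

    vertex : ∀ v → lookup X v ≡ true → V
    vertex v Xv = v , x∈p⇒x∉∁p (lookup⇒[]= v X Xv)

    unreached-along : ∀ {u v} → Star E u v →
      lookup (residue nbhd X) (proj₁ u) ≡ false → lookup (residue nbhd X) (proj₁ v) ≡ false
    unreached-along ε u∉R = u∉R
    unreached-along {u} (_◅_ {j = w} uw wv) u∉R =
      unreached-along wv (residue-stable uw (inX u) (inX w) u∉R)

    -- Absence from the residue spreads along paths from the first vertex `s` of `X`. Connectedness
    -- would carry it to the vertex `i` of the residue.
    residue⇒disconnected : or (residue nbhd X) ≡ true → ¬ Connected E
    residue⇒disconnected R≢∅ conn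
      with i , i∈R ← or-true (residue nbhd X) R≢∅
      with i∈X ← []=⇒lookup (iter-⊆ (prune-⊆ nbhd X) n X (lookup⇒[]= i _ i∈R))
      with s , fs@(s∈X , _) ← first X i i∈X
      = contradiction
          (trans (sym i∈R) (unreached-along (conn (vertex s s∈X) (vertex i i∈X))
            -- The residue is itself a pruned set, and pruning always drops the first vertex.
            (subst (λ U → lookup U s ≡ false) prune-residue (First∉prune fs _))))
          λ ()

    module _ {s} (fs : First X s) where

      Reached : Subset n → Set
      Reached U = ∀ (v : V) → lookup U (proj₁ v) ≡ false → Star E (vertex s (proj₁ fs)) v

      -- A vertex of `X` that is newly dropped is either `s` itself or adjacent to a vertex of `X`
      -- dropped earlier, whose path is extended by one edge.
      reached-prune : ∀ U → Reached U → Reached (f U)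
      reached-prune U reached v@(i , i∉∁X) i∉fU
        with perishes (marked-before X i) (touches (nbhd i) X U) (lookup U i)
               (trans (cong (λ x → survives (marked-before X i) x (touches (nbhd i) X U) (lookup U i))
                 (sym (inX v)))
                 (trans (sym (lookup-sweep X U false nbhd X U i)) i∉fU))
      ... | inj₁ none with refl ← First-unique X (inX v , none) fs = ε
      ... | inj₂ (inj₂ i∉U) = reached v i∉U
      ... | inj₂ (inj₁ touched) with j , ij , Xj , j∉U ← touches⁻ (nbhd i) X U touched =
        reached (vertex j Xj) j∉U
          ◅◅ (trans (adj-sym G j i) (trans (sym (lookup∘tabulate (adj G i) j)) ij) ◅ ε)

      reached-iter : ∀ k U → Reached U → Reached (iter k f U)
      reached-iter zero    U reached = reached
      reached-iter (suc k) U reached = reached-iter k (f U) (reached-prune U reached)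

    residue⇒connected : or (residue nbhd X) ≡ false → Connected E
    -- The vertex `u` shows that `X` has a first vertex `s`; paths from `s` to `u` and to `v` are
    -- then joined.
    residue⇒connected R≡∅ u v with s , fs ← first X (proj₁ u) (inX u) =
      reverse (λ {a} {b} ab → trans (adj-sym G (proj₁ b) (proj₁ a)) ab) (from u) ◅◅ from v
      where
      from : (v : V) → Star E (vertex s (proj₁ fs)) v
      -- The search starts with `U` equal to `X`, where the invariant holds vacuously.
      from v = reached-iter fs n X (λ v v∉X → contradiction (trans (sym (inX v)) v∉X) λ ())
        v (or-false (residue nbhd X) R≡∅ _)

-- Independent cutsets as complements of vertex covers

any-true : ∀ {A : Set} (f : A → Bool) xs → any f xs ≡ true → ∃ λ x → x List.∈ xs × f x ≡ true
any-true f (x ∷ xs) t with f x in fx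
... | true  = x , here refl , fx
... | false with y , y∈ , fy ← any-true f xs t = y , there y∈ , fy

any-false : ∀ {A : Set} (f : A → Bool) xs → any f xs ≡ false → ∀ {x} → x List.∈ xs → f x ≡ false
any-false f (x ∷ xs) t (here refl) with f x
... | false = refl
any-false f (x ∷ xs) t (there x∈) with f x
... | false = any-false f xs t x∈

∁-involutive : ∀ (S : Subset n) → ∁ (∁ S) ≡ S
∁-involutive S = ⊆-antisym (λ x∈ → x∉∁p⇒x∈p (x∈∁p⇒x∉p x∈)) (λ x∈ → x∉p⇒x∈∁p (x∈p⇒x∉∁p x∈))

∁-≤ : ∀ (S : Subset n) k → n ∸ k ≤ ∣ S ∣ → ∣ ∁ S ∣ ≤ k
∁-≤ {n} S k le = begin
  ∣ ∁ S ∣         ≡⟨ ∣∁p∣≡n∸∣p∣ S ⟩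
  n ∸ ∣ S ∣       ≤⟨ m≤n+o⇒m∸n≤o n ∣ S ∣ (begin
    -- This also covers `k > n`, where the difference is truncated to zero.
    n             ≤⟨ m≤n+m∸n n k ⟩
    k + (n ∸ k)   ≤⟨ +-monoʳ-≤ k le ⟩
    k + ∣ S ∣     ≡⟨ +-comm k ∣ S ∣ ⟩
    ∣ S ∣ + k     ∎) ⟩
  k               ∎
  where open ≤-Reasoning

module _ (G : Graph n) (k : ℕ) where

  independent-∁ : ∀ {X} → VertexCover G X → Independent G (∁ X)
  independent-∁ cover u v u∈ v∈ uv =
    [ x∈∁p⇒x∉p u∈ , x∈∁p⇒x∉p v∈ ]′ (cover u v uv)

  cover-∁ : ∀ {S} → Independent G S → VertexCover G (∁ S)
  cover-∁ {S} ind u v uv with u ∈? S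
  ... | no  u∉S = inj₁ (x∉p⇒x∈∁p u∉S)
  ... | yes u∈S = inj₂ (x∉p⇒x∈∁p λ v∈S → ind u v u∈S v∈S uv)

  -- A nonempty residue makes the complement of a listed cover a cutset. Conversely, the complement
  -- of a cutset as required is in the list, so the test cannot have missed it.
  decides : ∀ L → (∀ X → X List.∈ L ⇔ (VertexCover G X × ∣ X ∣ ≤ k)) →
    IndependentCutsetDecision G k (encBool (any (or ∘ residue (nbhd G)) L))
  decides L spec with any (or ∘ residue (nbhd G)) L in eq
  ... | true  with X , X∈L , R≢∅ ← any-true (or ∘ residue (nbhd G)) L eq
              with cover , ∣X∣≤k ← Equivalence.to (spec X) X∈L =
    yes (∁ X , residue⇒disconnected G X R≢∅ , independent-∁ cover
        , subst (n ∸ k ≤_) (sym (∣∁p∣≡n∸∣p∣ X)) (∸-monoʳ-≤ n ∣X∣≤k)) , refl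
  ... | false = no none , refl
    where
    none : ¬ HasIndependentCutset≥n- G k
    -- The test of `∁ S` concerns `G` minus `∁ (∁ S)`, which has to be identified with `S`.
    none (S , cutset , ind , large) = cutset (subst (λ T → Connected (_∖_ G T)) (∁-involutive S)
      (residue⇒connected G (∁ S) (any-false (or ∘ residue (nbhd G)) L eq
        (Equivalence.from (spec (∁ S)) (cover-∁ ind , ∁-≤ S k large)))))

-- The decision program

record Regs : Set where
  field
    out graph covers cover alive count rows xs us acc seen hit p q r : Tree

blank : Regs
blank = record
  { out = nil ; graph = nil ; covers = nil ; cover = nil ; alive = nil
  ; count = nil ; rows = nil ; xs = nil ; us = nil ; acc = nil ; seen = nil
  ; hit = nil ; p = nil ; q = nil ; r = nil }

-- With registers as record fields, an invariant is a record update naming only the registers it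
-- concerns. The tail `σ` holds the variables of the enumeration.
store : Regs → Store l → Store (15 + l)
store ρ σ = out ∷ graph ∷ covers ∷ cover ∷ alive ∷ count ∷ rows ∷ xs ∷ us ∷ acc
  ∷ seen ∷ hit ∷ p ∷ q ∷ r ∷ σ
  where open Regs ρ

module _ {l : ℕ} where

  out graph covers cover alive count rows xs us acc seen hit p q r : Fin (15 + l)
  out    = # 0 ↑ˡ l
  graph  = # 1 ↑ˡ l
  covers = # 2 ↑ˡ l
  cover  = # 3 ↑ˡ l
  alive  = # 4 ↑ˡ l
  count  = # 5 ↑ˡ l
  rows   = # 6 ↑ˡ l
  xs     = # 7 ↑ˡ l
  us     = # 8 ↑ˡ l
  acc    = # 9 ↑ˡ l
  seen   = # 10 ↑ˡ l
  hit    = # 11 ↑ˡ l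
  p      = # 12 ↑ˡ l
  q      = # 13 ↑ˡ l
  r      = # 14 ↑ˡ l

  pop : Fin (15 + l) → Cmd (15 + l)
  pop x = x := tl (var x)

  -- The language has no empty command.
  skip : Cmd (15 + l)
  skip = out := var out

  touchStep touchLoop sweepPre sweepPost sweepLoop reverseStep reverseLoop
    prunePre pruneMid pruneAll closureLoop orStep orLoop coverPre coverMid coverPost
    coverStep coverLoop : Cmd (15 + l)

  touchStep =
    (if hd (var p)
     then (if hd (var q) then (if hd (var r) then skip else (hit := cons nil nil)) else skip)
     else skip)
    ⨾ pop p ⨾ pop q ⨾ pop r
  touchLoop = while var p loop touchStep

  -- `touchLoop` consumes its three lists, so it is given copies.
  sweepPre = p := hd (var rows) ⨾ q := var cover ⨾ r := var alive
  sweepPost =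
    (if hd (var xs)
     then (if var seen
           then (if var hit then acc := cons nil (var acc) else (acc := cons (hd (var us)) (var acc)))
           else (seen := cons nil nil ⨾ acc := cons nil (var acc)))
     else (acc := cons (hd (var us)) (var acc)))
    ⨾ hit := nil ⨾ pop rows ⨾ pop xs ⨾ pop us
  sweepLoop = while var rows loop (sweepPre ⨾ touchLoop ⨾ sweepPost)

  -- A sweep conses its results onto `acc`, which therefore holds them in reverse order.
  reverseStep = alive := cons (hd (var acc)) (var alive) ⨾ pop acc
  reverseLoop = while var acc loop reverseStep

  prunePre = rows := var graph ⨾ xs := var cover ⨾ us := var alive
  pruneMid = seen := nil ⨾ alive := nil
  pruneAll = prunePre ⨾ sweepLoop ⨾ pruneMid ⨾ reverseLoop ⨾ pop count
  closureLoop = while var count loop pruneAll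

  orStep = (if hd (var us) then out := cons nil nil else skip) ⨾ pop us
  orLoop = while var us loop orStep

  -- The adjacency matrix has as many rows as there are vertices, so a copy of it serves as a unary
  -- counter of the rounds.
  coverPre  = cover := hd (var covers) ⨾ alive := var cover ⨾ count := var graph
  coverMid  = us := var alive
  -- Clears what the round has left behind, so that the store has the form `coverState` again.
  coverPost = cover := nil ⨾ alive := nil ⨾ pop covers
  coverStep = coverPre ⨾ closureLoop ⨾ coverMid ⨾ orLoop ⨾ coverPost
  coverLoop = while var covers loop coverStep

  -- In the following time bounds, k is one more than the number of vertices.
  touchTime sweepStepTime pruneTime coverTime : ℕ → ℕ
  touchTime k = loopTime k (bound touchStep)
  sweepStepTime k = bound sweepPre + (touchTime k + bound sweepPost)
  pruneTime k = bound prunePre + (loopTime k (sweepStepTime k) + (bound pruneMid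
    + (loopTime k (bound reverseStep) + bound (pop count))))
  coverTime k = bound coverPre + (loopTime k (pruneTime k) + (bound coverMid
    + (loopTime k (bound orStep) + bound coverPost)))

  -- Effects and running times of the loops

  touchLoop⇓ : ∀ (as xs us : Vec Bool n) h ρ (σ : Store l) →
    ⟨ touchLoop , store (record ρ { p = encSubset as ; q = encSubset xs ; r = encSubset us
                                  ; hit = encBool h }) σ ⟩⇓≤[ touchTime (suc n) ]
    store (record ρ { p = nil ; q = nil ; r = nil ; hit = encBool (h ∨ touches as xs us) }) σ
  touchLoop⇓ [] [] [] false ρ σ = while-done refl
  touchLoop⇓ [] [] [] true  ρ σ = while-done refl
  touchLoop⇓ (false ∷ as) (x ∷ xs) (u ∷ us) h ρ σ =
    while-step truthy (run⇓ touchStep _) (touchLoop⇓ as xs us h ρ σ)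
  touchLoop⇓ (true ∷ as) (false ∷ xs) (u ∷ us) h ρ σ =
    while-step truthy (run⇓ touchStep _) (touchLoop⇓ as xs us h ρ σ)
  touchLoop⇓ (true ∷ as) (true ∷ xs) (true ∷ us) h ρ σ =
    while-step truthy (run⇓ touchStep _) (touchLoop⇓ as xs us h ρ σ)
  touchLoop⇓ (true ∷ as) (true ∷ xs) (false ∷ us) false ρ σ =
    while-step truthy (run⇓ touchStep _) (touchLoop⇓ as xs us true ρ σ)
  touchLoop⇓ (true ∷ as) (true ∷ xs) (false ∷ us) true ρ σ =
    while-step truthy (run⇓ touchStep _) (touchLoop⇓ as xs us true ρ σ)

  -- The cases are those in which all branches of `sweepPost` are determined, so that `run⇓` settles
  -- each by computation.
  sweepPost⇓ : ∀ s x h u rs (xs us : Tree) as ρ (σ : Store l) →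
    ⟨ sweepPost , store (record ρ { rows = rs ; xs = cons (encBool x) xs ; us = cons (encBool u) us
                                  ; acc = as ; seen = encBool s ; hit = encBool h }) σ ⟩⇓≤[
      bound sweepPost ]
    store (record ρ { rows = tail rs ; xs = xs ; us = us ; acc = cons (encBool (survives s x h u)) as
                    ; seen = encBool (s ∨ x) ; hit = nil }) σ
  sweepPost⇓ false false h     u rs xs us as ρ σ = run⇓ sweepPost _
  sweepPost⇓ true  false h     u rs xs us as ρ σ = run⇓ sweepPost _
  sweepPost⇓ false true  h     u rs xs us as ρ σ = run⇓ sweepPost _
  sweepPost⇓ true  true  false u rs xs us as ρ σ = run⇓ sweepPost _
  sweepPost⇓ true  true  true  u rs xs us as ρ σ = run⇓ sweepPost _

  module _ (X U : Subset n) (ρ : Regs) (σ : Store l) where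

    sweepLoop⇓ : ∀ s (N : Fin m → Subset n) (xs us : Vec Bool m) as →
      ⟨ sweepLoop , store (record ρ
        { cover = encSubset X ; alive = encSubset U ; rows = encList encSubset (tabulate N)
        ; xs = encSubset xs ; us = encSubset us ; acc = encList encBool as ; seen = encBool s
        ; hit = nil ; p = nil ; q = nil ; r = nil }) σ ⟩⇓≤[ loopTime (suc m) (sweepStepTime (suc n)) ]
      store (record ρ
        { cover = encSubset X ; alive = encSubset U ; rows = nil ; xs = nil ; us = nil
        ; acc = encList encBool (toList (sweep X U s N xs us) ʳ++ as)
        ; seen = encBool (foldl′ _∨_ s xs)
        ; hit = nil ; p = nil ; q = nil ; r = nil }) σ
    sweepLoop⇓ s N [] [] as = while-done refl
    sweepLoop⇓ s N (x ∷ xs) (u ∷ us) as =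
      while-step truthy
        (run⇓ sweepPre _
          ⨟ touchLoop⇓ (N zero) X U false
              (record ρ { cover = _ ; alive = _ ; rows = _ ; xs = _ ; us = _ ; acc = _ ; seen = _ }) σ
          ⨟ sweepPost⇓ s x _ u _ _ _ _
              (record ρ { cover = _ ; alive = _ ; p = _ ; q = _ ; r = _ }) σ)
        (sweepLoop⇓ (s ∨ x) (N ∘ suc) xs us _)

  reverseLoop⇓ : ∀ (as bs : List Bool) ρ (σ : Store l) →
    ⟨ reverseLoop , store (record ρ { acc = encList encBool as ; alive = encList encBool bs }) σ ⟩⇓≤[
      loopTime (suc (List.length as)) (bound reverseStep) ]
    store (record ρ { acc = nil ; alive = encList encBool (as ʳ++ bs) }) σ
  reverseLoop⇓ [] bs ρ σ = while-done refl
  reverseLoop⇓ (a ∷ as) bs ρ σ =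
    while-step truthy (run⇓ reverseStep _) (reverseLoop⇓ as (a ∷ bs) ρ σ)

  reverseBits⇓ : ∀ (v : Vec Bool n) ρ (σ : Store l) →
    ⟨ reverseLoop , store (record ρ { acc = encList encBool (toList v ʳ++ []) ; alive = nil }) σ ⟩⇓≤[
      loopTime (suc n) (bound reverseStep) ]
    store (record ρ { acc = nil ; alive = encSubset v }) σ
  reverseBits⇓ v ρ σ =
    subst₂ (λ k bs →
        ⟨ reverseLoop
        , store (record ρ { acc = encList encBool (List.reverse (toList v)) ; alive = nil }) σ
        ⟩⇓≤[ loopTime (suc k) (bound reverseStep) ]
        store (record ρ { acc = nil ; alive = encList encBool bs }) σ)
      (trans (length-reverse (toList v)) (length-toList v)) (reverse-involutive (toList v))
      (reverseLoop⇓ (List.reverse (toList v)) [] ρ σ)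

  module _ (N : Fin n → Subset n) (X : Subset n) (ρ : Regs) (σ : Store l) where

    closureState : (U : Subset n) (count : Tree) → Store (15 + l)
    closureState U c = store (record ρ
      { graph = encList encSubset (tabulate N) ; cover = encSubset X ; alive = encSubset U
      ; count = c ; rows = nil ; xs = nil ; us = nil ; acc = nil ; seen = nil
      ; hit = nil ; p = nil ; q = nil ; r = nil }) σ

    -- The counter `ticks` is separate from `N`, so that the induction can shorten it while the
    -- matrix in `graph` stays whole. In use both are the matrix.
    closureLoop⇓ : ∀ (ticks : Fin m → Subset n) U →
      ⟨ closureLoop , closureState U (encList encSubset (tabulate ticks)) ⟩⇓≤[
        loopTime (suc m) (pruneTime (suc n)) ]
      closureState (iter m (prune N X) U) nil
    closureLoop⇓ {zero}  ticks U = while-done refl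
    closureLoop⇓ {suc m} ticks U =
      while-step truthy
        (run⇓ prunePre _ ⨟ sweepLoop⇓ X U (record ρ { graph = _ ; count = _ }) σ false N X U []
          ⨟ run⇓ pruneMid _
          ⨟ reverseBits⇓ (prune N X U)
              (record ρ { graph = _ ; cover = _ ; count = _ ; rows = _ ; xs = _ ; us = _ ; seen = _
                        ; hit = _ ; p = _ ; q = _ ; r = _ }) σ
          ⨟ run⇓ (pop count) _)
        (closureLoop⇓ (ticks ∘ suc) (prune N X U))

  orLoop⇓ : ∀ (v : Vec Bool n) b ρ (σ : Store l) →
    ⟨ orLoop , store (record ρ { us = encSubset v ; out = encBool b }) σ ⟩⇓≤[ loopTime (suc n) (bound orStep) ]
    store (record ρ { us = nil ; out = encBool (b ∨ or v) }) σ
  orLoop⇓ []          false ρ σ = while-done refl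
  orLoop⇓ []          true  ρ σ = while-done refl
  orLoop⇓ (false ∷ v) b     ρ σ = while-step truthy (run⇓ orStep _) (orLoop⇓ v b ρ σ)
  orLoop⇓ (true ∷ v)  false ρ σ = while-step truthy (run⇓ orStep _) (orLoop⇓ v true ρ σ)
  orLoop⇓ (true ∷ v)  true  ρ σ = while-step truthy (run⇓ orStep _) (orLoop⇓ v true ρ σ)

  module _ (N : Fin n → Subset n) (σ : Store l) where

    coverState : List (Subset n) → Bool → Store (15 + l)
    coverState L b = store (record blank
      { out = encBool b ; graph = encList encSubset (tabulate N) ; covers = encList encSubset L }) σ

    coverLoop⇓ : ∀ L b →
      ⟨ coverLoop , coverState L b ⟩⇓≤[ loopTime (suc (List.length L)) (coverTime (suc n)) ]
      coverState [] (b ∨ any (or ∘ residue N) L)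
    coverLoop⇓ [] false = while-done refl
    coverLoop⇓ [] true  = while-done refl
    coverLoop⇓ (X ∷ L) b =
      while-step truthy
        (run⇓ coverPre _ ⨟ closureLoop⇓ N X (record blank { out = _ ; covers = _ }) σ N X
          ⨟ run⇓ coverMid _
          ⨟ orLoop⇓ (residue N X) b (record blank { graph = _ ; covers = _ ; cover = _ ; alive = _ }) σ
          ⨟ run⇓ coverPost _)
        (subst (λ c → ⟨ coverLoop , coverState L (b ∨ or (residue N X)) ⟩⇓≤[ _ ] coverState [] c)
          (∨-assoc b (or (residue N X)) (any (or ∘ residue N) L))
          (coverLoop⇓ L (b ∨ or (residue N X))))

-- Composition with the enumeration

module _ (A : Program) where

  -- Variable `15` is the first one of `A`. It receives a copy of the input, while `out` keeps the
  -- graph for the tests.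
  before after decider : Cmd (15 + suc (locals A))
  before = (15 ↑ʳ zero) := var out
  after  = covers := var (15 ↑ʳ zero) ⨾ graph := hd (var out) ⨾ out := nil
  decider = before ⨾ shift 15 (body A) ⨾ after ⨾ coverLoop

  deciderProgram : Program
  deciderProgram = record { locals = 14 + suc (locals A) ; body = decider }

  decider⇓ : ∀ (G : Graph n) k L {t} → Runs A (encInput G k) (encList encSubset L) t →
    ∃ λ t′ → Runs deciderProgram (encInput G k) (encBool (any (or ∘ residue (nbhd G)) L)) t′ ×
      t′ ≤ bound before + (t + (bound after
        + loopTime (suc (List.length L)) (coverTime {suc (locals A)} (suc n))))
  decider⇓ G k L {t} (τ , A⇓ , τ₀≡)
    with t′ , B⇓ , t′≤ ← run⇓ before (store (record blank { out = encInput G k }) (replicate _ nil))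
           ⨟ (_ , shift⇓ (store (record blank { out = encInput G k }) []) A⇓ , ≤-refl)
           ⨟ run⇓ after _
           -- The register `covers` holds the output of `A`, which `τ₀≡` identifies with the
           -- encoding of `L`.
           ⨟ subst (λ T → ⟨ coverLoop , store (record blank { graph = encGraph G ; covers = T }) τ ⟩⇓≤[ _ ]
                         coverState (nbhd G) τ [] _)
               (sym τ₀≡) (coverLoop⇓ (nbhd G) τ L false)
    = t′ , (_ , B⇓ , refl) , t′≤

-- The running time

-- Times are computed from the number of vertices, but the claim is about the input size, an `N`
-- that is merely at least `k`. By `1 ≤ k`, `N` is positive, so exponents may be raised.
PolyBounded : (ℕ → ℕ) → Set
PolyBounded g = ∃₂ λ c d → ∀ {k N} → 1 ≤ k → k ≤ N → g k ≤ c * N ^ d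

poly-const : ∀ a → PolyBounded (λ _ → a)
poly-const a = a , 0 , λ _ _ → ≤-reflexive (sym (*-identityʳ a))

poly-+ : ∀ {g h} → PolyBounded g → PolyBounded h → PolyBounded (λ k → g k + h k)
poly-+ {g} {h} (c , d , g≤) (c′ , d′ , h≤) = c + c′ , d + d′ , λ {k} {N} 1≤k k≤N →
  let instance _ = >-nonZero (≤-trans 1≤k k≤N) in begin
    g k + h k                                 ≤⟨ +-mono-≤ (g≤ 1≤k k≤N) (h≤ 1≤k k≤N) ⟩
    c * N ^ d + c′ * N ^ d′                   ≤⟨ +-mono-≤ (*-monoʳ-≤ c (^-monoʳ-≤ N (m≤m+n d d′)))
                                                            (*-monoʳ-≤ c′ (^-monoʳ-≤ N (m≤n+m d′ d))) ⟩
    c * N ^ (d + d′) + c′ * N ^ (d + d′)      ≡⟨ *-distribʳ-+ (N ^ (d + d′)) c c′ ⟨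
    (c + c′) * N ^ (d + d′)                   ∎
  where open ≤-Reasoning

opaque
  unfolding loopTime

  poly-loop : ∀ {g} → PolyBounded g → PolyBounded (λ k → loopTime k (g k))
  poly-loop {g} g-poly with c , d , g≤ ← poly-+ (poly-const 2) g-poly =
    c , suc d , λ {k} {N} 1≤k k≤N → begin
      k * (2 + g k)    ≤⟨ *-mono-≤ k≤N (g≤ 1≤k k≤N) ⟩
      N * (c * N ^ d)  ≡⟨ rearrange N c (N ^ d) ⟩
      c * (N * N ^ d)  ∎
    where
    open ≤-Reasoning
    rearrange : ∀ x y z → x * (y * z) ≡ y * (x * z)
    rearrange = solve-∀

module _ {l : ℕ} where

  private
    fixed : (c : Cmd (15 + l)) → PolyBounded (λ _ → bound c)
    fixed c = poly-const (bound c)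

  sweepStepTime-poly : PolyBounded (sweepStepTime {l})
  sweepStepTime-poly = poly-+ (fixed sweepPre) (poly-+ (poly-loop (fixed touchStep)) (fixed sweepPost))

  pruneTime-poly : PolyBounded (pruneTime {l})
  pruneTime-poly = poly-+ (fixed prunePre) (poly-+ (poly-loop sweepStepTime-poly)
    (poly-+ (fixed pruneMid) (poly-+ (poly-loop (fixed reverseStep)) (fixed (pop count)))))

  coverTime-poly : PolyBounded (coverTime {l})
  coverTime-poly = poly-+ (fixed coverPre) (poly-+ (poly-loop pruneTime-poly)
    (poly-+ (fixed coverMid) (poly-+ (poly-loop (fixed orStep)) (fixed coverPost))))

-- Strictness matters, as the time bounds are taken at `suc n`.
order<size : ∀ (G : Graph n) k → n < size (encInput G k)
order<size {n} G k = begin-strict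
  n                              ≡⟨ length-tabulate (λ u → Vec.tabulate (adj G u)) ⟨
  List.length (tabulate λ u → Vec.tabulate (adj G u)) <⟨ length<size encSubset (tabulate λ u → Vec.tabulate (adj G u)) ⟩
  size (encGraph G)              ≤⟨ m≤n⇒m≤1+n (m≤m+n _ _) ⟩
  size (encInput G k)            ∎
  where
  open ≤-Reasoning

opaque
  unfolding loopTime

  -- Here `t` and `ℓ` are time and output length of the enumeration, and `T` is the time per cover.
  -- Since a run takes at least one step, the enumeration's budget `W` is positive, so additive
  -- constants can be absorbed into multiples of `D`.
  decider-budget : ∀ a b {N t ℓ T} c d c′ d′ F → 1 ≤ N → 1 ≤ t → t ≤ c * N ^ d * F → ℓ ≤ t + N →
    2 + T ≤ c′ * N ^ d′ →
    a + (t + (b + loopTime (suc ℓ) T)) ≤ (a + 1 + b + 3 * c′) * c * N ^ (suc d′ + d) * F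
  decider-budget a b {N} {t} {ℓ} {T} c d c′ d′ F 1≤N 1≤t t≤W ℓ≤ T≤ = begin
    a + (t + (b + suc ℓ * (2 + T)))
      ≤⟨ +-mono-≤ (≤D a) (+-mono-≤ (≤-trans t≤W W≤D) (+-mono-≤ (≤D b) (*-mono-≤ ℓ<3NW T≤))) ⟩
    a * D + (D + (b * D + 3 * (N * W) * (c′ * N ^ d′)))
      ≡⟨ collect a b c′ c N (N ^ d′) (N ^ d) F ⟩
    (a + 1 + b + 3 * c′) * c * (N ^ suc d′ * N ^ d) * F
      ≡⟨ cong (λ x → (a + 1 + b + 3 * c′) * c * x * F) (^-distribˡ-+-* N (suc d′) d) ⟨
    (a + 1 + b + 3 * c′) * c * N ^ (suc d′ + d) * F ∎
    where
    open ≤-Reasoning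
    W D : ℕ
    W = c * N ^ d * F
    D = N ^ suc d′ * W
    1≤W : 1 ≤ W
    1≤W = ≤-trans 1≤t t≤W
    instance
      N≢0 : NonZero N
      N≢0 = >-nonZero 1≤N
      W≢0 : NonZero W
      W≢0 = >-nonZero 1≤W
      N^d≢0 : NonZero (N ^ suc d′)
      N^d≢0 = m^n≢0 N (suc d′)
    W≤D : W ≤ D
    W≤D = m≤n*m W (N ^ suc d′)
    ≤D : ∀ x → x ≤ x * D
    ≤D x = ≤-trans (≤-reflexive (sym (*-identityʳ x))) (*-monoʳ-≤ x (≤-trans 1≤W W≤D))
    ℓ<3NW : suc ℓ ≤ 3 * (N * W)
    -- Each of `1`, `t` and `N` is at most `N * W`, whence the factor `3`.
    ℓ<3NW = begin
      suc ℓ                           ≤⟨ s≤s ℓ≤ ⟩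
      1 + (t + N)                     ≤⟨ +-mono-≤ (*-mono-≤ 1≤N 1≤W)
                                           (+-mono-≤ (≤-trans t≤W (m≤n*m W N)) (m≤m*n N W)) ⟩
      N * W + (N * W + N * W)         ≡⟨ cong (λ x → N * W + (N * W + x)) (+-identityʳ (N * W)) ⟨
      3 * (N * W)                     ∎
    collect : ∀ a b c′ c N P Q F → let W = c * Q * F; D = N * P * W in
      a * D + (D + (b * D + 3 * (N * W) * (c′ * P))) ≡ (a + 1 + b + 3 * c′) * c * (N * P * Q) * F
    collect = solve-∀

decider-solves : ∀ (𝒢 : GraphClass) f A → A solves VertexCoverEnumeration on 𝒢 in𝒪* f →
  PolyBounded (λ k → 2 + coverTime {suc (locals A)} k) →
  deciderProgram A solves IndependentCutsetDecision on 𝒢 in𝒪* f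
decider-solves 𝒢 f A (c , d , solves) (c′ , d′ , cover≤) =
  (bound (before A) + 1 + bound (after A) + 3 * c′) * c , suc d′ + d , λ G G∈𝒢 k →
  let out , t , A⇓@(_ , c⇓ , _) , (L , out≡ , spec) , t≤ = solves G G∈𝒢 k
      A⇓L = subst (λ o → Runs A (encInput G k) o t) out≡ A⇓
      t′ , B⇓ , t′≤ = decider⇓ A G k L A⇓L
  in encBool (any (or ∘ residue (nbhd G)) L) , t′ , B⇓ , decides G k L spec ,
     ≤-trans t′≤ (decider-budget (bound (before A)) (bound (after A)) c d c′ d′ (f k)
       (≤-trans (s≤s z≤n) (order<size G k)) (⇓-pos c⇓) t≤
       (length-output encSubset A L A⇓L) (cover≤ (s≤s z≤n) (order<size G k)))

theorem4p2 : (𝒢 : GraphClass) → (∀ {n} (G : Graph n) → 𝒢 G → Connected (Adj G)) →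
    (f : ℕ → ℕ) →
    (∃ λ (A : Program) → A solves VertexCoverEnumeration on 𝒢 in𝒪* f) →
    ∃ λ (B : Program) → B solves IndependentCutsetDecision on 𝒢 in𝒪* f
theorem4p2 𝒢 _ f (A , A-solves) =
  -- The summand `2` pays for the test of `coverLoop` before each cover.
  deciderProgram A , decider-solves 𝒢 f A A-solves (poly-+ (poly-const 2) (coverTime-poly {suc (locals A)}))
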